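{- There is a focally adequate encoding of (polarised) intuitionistic logic, i.e. $\mathrm{ISL}(\mathtt{l})$, in (polarised) classical linear logic, i.e. $\mathrm{CSL}(\mathtt{ll})$. The signatures $\mathtt l,\mathtt{ll}$ and the notions used are defined in the context.
   Context: **Signatures.** A subexponential signature is $\Sigma=\langle Z,\le,\mathsf w,U\rangle$ where $\langle Z,\le\rangle$ is a non-empty preordered set (of "zones"), $\mathsf w\in Z$ is the working zone, and $U\subseteq Z$ (the unrestricted zones) is upward closed: $z_1\le z_2$ and $z_1\in U$ imply $z_2\in U$. Zones in $Z\setminus U$ are restricted. Letters $u$ range over unrestricted zones, $r$ over restricted zones, $x,y,z$ over all zones. Particular signatures (each preorder being the reflexive closure of the listed relations): - $\mathtt{l}$: $Z=\{\mathsf w\}$, working zone $\mathsf w$, $U=\{\mathsf w\}$. - $\mathtt{ll}$: $Z=\{\mathsf w,\mathsf u\}$, $\mathsf w\le\mathsf u$, working zone $\mathsf w$, $U=\{\mathsf u\}$. **Formulas.** Each atom is either positive ($p,q$) or negative ($n,m$). Classical formulas: positive $P,Q::=p\mid P\otimes Q\mid 1\mid P\oplus Q\mid 0\mid\ !_z\check N$; negative $N,M::=n\mid N\& M\mid\top\mid N⅋ M\mid\bot\mid P\multimap N\mid\ ?_z\hat P$. Here $z\in Z$, $\hat P$ (or $\hat Q$) denotes a positive formula or a negative atom, and $\check N$ denotes a negative formula or a positive atom. Intuitionistic formulas are the same without $⅋$ and $\bot$. $A$ is an arbitrary formula and $a$ an arbitrary atom. **Contexts.** $\Gamma$ (left passive):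 elements $z{:}\check N$. $\Delta$ (right passive): elements $z{:}\hat P$. $\Omega$ (left active): elements $\hat P$. $\Xi$ (right active): elements $\check N$. Contexts are finite multisets of occurrences; derivations that act on different occurrences are counted as different. $\Gamma^u,\Delta^u$ denote passive contexts all of whose zones are unrestricted; $\Gamma^r_i,\Delta^r_i$ denote passive contexts all of whose zones are restricted. **Focused calculus $\mathrm{CSL}(\Sigma)$.** Sequents: $\Gamma\vdash[P];\Delta$ (right focus), $\Gamma;[N]\vdash\Delta$ (left focus), $\Gamma;\Omega\vdash\Xi;\Delta$ (active). Rules (premises $\Rightarrow$ conclusion; "$\Rightarrow S$" means no premises): - Right focus: $\Rightarrow\Gamma^u,z{:}p\vdash[p];\Delta^u$ (any $z$). From $\Gamma^u,\Gamma^r_1\vdash[P];\Delta^u,\Delta^r_1$ and $\Gamma^u,\Gamma^r_2\vdash[Q];\Delta^u,\Delta^r_2$ infer $\Gamma^u,\Gamma^r_1,\Gamma^r_2\vdash[P\otimes Q];\Delta^u,\Delta^r_1,\Delta^r_2$. $\Rightarrow\Gamma^u\vdash[1];\Delta^u$. $\Gamma\vdash[P_i];\Delta\Rightarrow\Gamma\vdash[P_1\oplus P_2];\Delta$ ($i=1,2$). $\Gamma;\cdot\vdash\check N;\Delta\Rightarrow\Gamma\vdash[!_z\check N];\Delta$ provided $z\le x$ for all $x{:}A$ in $\Gamma,\Delta$. (No rule for $0$.) - Left focus: $\Rightarrow\Gamma^u;[n]\vdash\Delta^u,z{:}n$ (any $z$). $\Gamma;[N_i]\vdash\Delta\Rightarrow\Gamma;[N_1\&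 N_2]\vdash\Delta$. From $\Gamma^u,\Gamma^r_1;[N]\vdash\Delta^u,\Delta^r_1$ and $\Gamma^u,\Gamma^r_2;[M]\vdash\Delta^u,\Delta^r_2$ infer $\Gamma^u,\Gamma^r_1,\Gamma^r_2;[N⅋ M]\vdash\Delta^u,\Delta^r_1,\Delta^r_2$. $\Rightarrow\Gamma^u;[\bot]\vdash\Delta^u$. From $\Gamma^u,\Gamma^r_1\vdash[P];\Delta^u,\Delta^r_1$ and $\Gamma^u,\Gamma^r_2;[M]\vdash\Delta^u,\Delta^r_2$ infer $\Gamma^u,\Gamma^r_1,\Gamma^r_2;[P\multimap M]\vdash\Delta^u,\Delta^r_1,\Delta^r_2$. $\Gamma;\hat P\vdash\cdot;\Delta\Rightarrow\Gamma;[?_z\hat P]\vdash\Delta$ provided $z\le x$ for all $x{:}A$ in $\Gamma,\Delta$. (No rule for $\top$.) - Right active: $\Gamma;\Omega\vdash\Xi;\Delta,\mathsf w{:}a\Rightarrow\Gamma;\Omega\vdash\Xi,a;\Delta$. $\Gamma;\Omega\vdash\Xi,N;\Delta$ and $\Gamma;\Omega\vdash\Xi,M;\Delta\Rightarrow\Gamma;\Omega\vdash\Xi,N\& M;\Delta$. $\Rightarrow\Gamma;\Omega\vdash\Xi,\top;\Delta$. $\Gamma;\Omega\vdash\Xi,N,M;\Delta\Rightarrow\Gamma;\Omega\vdash\Xi,N⅋ M;\Delta$. $\Gamma;\Omega\vdash\Xi;\Delta\Rightarrow\Gamma;\Omega\vdash\Xi,\bot;\Delta$. $\Gamma;\Omega,P\vdash\Xi,N;\Delta\Rightarrow\Gamma;\Omega\vdash\Xi,P\multimap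 N;\Delta$. $\Gamma;\Omega\vdash\Xi;\Delta,z{:}\hat P\Rightarrow\Gamma;\Omega\vdash\Xi,?_z\hat P;\Delta$. - Left active: $\Gamma,\mathsf w{:}a;\Omega\vdash\Xi;\Delta\Rightarrow\Gamma;\Omega,a\vdash\Xi;\Delta$. $\Gamma;\Omega,P,Q\vdash\Xi;\Delta\Rightarrow\Gamma;\Omega,P\otimes Q\vdash\Xi;\Delta$. $\Gamma;\Omega\vdash\Xi;\Delta\Rightarrow\Gamma;\Omega,1\vdash\Xi;\Delta$. $\Gamma;\Omega,P\vdash\Xi;\Delta$ and $\Gamma;\Omega,Q\vdash\Xi;\Delta\Rightarrow\Gamma;\Omega,P\oplus Q\vdash\Xi;\Delta$. $\Rightarrow\Gamma;\Omega,0\vdash\Xi;\Delta$. $\Gamma,z{:}\check N;\Omega\vdash\Xi;\Delta\Rightarrow\Gamma;\Omega,!_z\check N\vdash\Xi;\Delta$. - Decision ($P$ positive, $N$ negative): $\Gamma\vdash[P];\Delta\Rightarrow\Gamma;\cdot\vdash\cdot;\Delta,r{:}P$. $\Gamma\vdash[P];\Delta,u{:}P\Rightarrow\Gamma;\cdot\vdash\cdot;\Delta,u{:}P$. $\Gamma;[N]\vdash\Delta\Rightarrow\Gamma,r{:}N;\cdot\vdash\cdot;\Delta$. $\Gamma,u{:}N;[N]\vdash\Delta\Rightarrow\Gamma,u{:}N;\cdot\vdash\cdot;\Delta$. **Focused calculus $\mathrm{ISL}(\Sigma)$.** The restriction of the focused calculus $\mathrm{CSL}(\Sigma)$ to intuitionistic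 formulas and to exactly one formula on the right. Sequents: $\Gamma\vdash[P]$; $\Gamma;[N]\vdash z{:}\hat Q$; $\Gamma;\Omega\vdash\check N;\cdot$; $\Gamma;\Omega\vdash\cdot;z{:}\hat Q$. Its rules are those of $\mathrm{CSL}(\Sigma)$ for the remaining connectives with right contexts restricted accordingly: in right-focus rules the right passive context is empty (so the side condition of the $!_z$ rule concerns only $\Gamma$); in the left-focus rule for $P\multimap M$ the right formula $z{:}\hat Q$ goes to the premise focused on $M$; the side condition of the $?_z$ left-focus rule concerns $\Gamma$ and the zone of the right formula; the initial left-focus rule is $\Rightarrow\Gamma^u;[n]\vdash z{:}n$; the two right decision rules become the single rule $\Gamma\vdash[P]\Rightarrow\Gamma;\cdot\vdash\cdot;z{:}P$ for every zone $z$, with no copying. **Synthetic derivations.** A neutral sequent is one of the form $\Gamma;\cdot\vdash\cdot;\Delta$ (intuitionistically $\Gamma;\cdot\vdash\cdot;z{:}\hat Q$). A synthetic derivation with conclusion a neutral sequent $S$ is a finite derivation with root $S$ whose last rule is a decision rule, with no other decision rule, and all of whose open leaves (its open premises) are neutral sequents. Two synthetic derivations are identified if they differ only in the (inessential) way the active rules are applied, e.g. their order. **Focal adequacy.** An encoding $E$ of a source calculus in a target calculus maps neutral source sequents to neutral target sequents by translating each zoned formula of the sequent separately (the translation depending only on the zoned formula and the side on which it occurs; the result may be placed on either side), possibly together with a fixed additional zoned formula; the target may use additional fresh atoms. $E$ is focally adequate if source and target have the same synthetic inference rules: for every neutral source sequent $S$ there is a bijection between the synthetic derivations with conclusion $S$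 and those of the target with conclusion $E(S)$, under which a derivation with open premises $S_1,\dots,S_n$ corresponds to one with open premises $E(S_1),\dots,E(S_n)$. -}

module Defs where

open import Data.Empty using (⊥)
open import Data.List.Base using (List; []; _∷_; [_]; _++_; map; fromMaybe; partitionSums)
open import Data.List.Membership.Propositional using (_∈_)
open import Data.List.Relation.Binary.Permutation.Homogeneous using (Permutation)
open import Data.List.Relation.Binary.Permutation.Propositional using (_↭_)
open import Data.List.Relation.Unary.All using (All)
open import Data.List.Relation.Unary.Any using (_─_)
open import Data.Maybe.Base using (Maybe)
open import Data.Product.Base using (_×_; _,_; proj₁; Σ-syntax)
open import Data.Sum.Base using (_⊎_; inj₁; inj₂)
open import Data.Unit.Base using (⊤)
open import Function.Base using (_∘_)
open import Function.Bundles using (Inverse)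
open import Level using (0ℓ)
open import Relation.Binary.Bundles using (Setoid)
open import Relation.Binary.Core using (Rel)
open import Relation.Binary.Construct.Closure.Reflexive using (ReflClosure; refl)
  renaming ([_] to step)
import Relation.Binary.Construct.Closure.Reflexive.Properties as ReflClosure
open import Relation.Binary.PropositionalEquality.Core using (_≡_)
open import Relation.Binary.Structures using (IsPreorder)
open import Relation.Nullary.Negation.Core using (¬_)
open import Relation.Unary using (Pred)

record Signature : Set₁ where
  field
    Z          : Set
    _≤_        : Rel Z 0ℓ
    isPreorder : IsPreorder _≡_ _≤_
    w          : Z
    U          : Pred Z 0ℓ
    U-upward   : ∀ {z₁ z₂} → z₁ ≤ z₂ → U z₁ → U z₂

module Signature-l where

  data Zone : Set where
    w : Zone

  data _↝_ : Rel Zone 0ℓ where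

  l : Signature
  l = record
    { Z          = Zone
    ; _≤_        = ReflClosure _↝_
    ; isPreorder = ReflClosure.isPreorder λ ()
    ; w          = w
    ; U          = λ _ → ⊤
    ; U-upward   = λ _ _ → _
    }

module Signature-ll where

  data Zone : Set where
    w u : Zone

  data _↝_ : Rel Zone 0ℓ where
    w↝u : w ↝ u

  data Unrestricted : Pred Zone 0ℓ where
    u : Unrestricted u

  ll : Signature
  ll = record
    { Z          = Zone
    ; _≤_        = ReflClosure _↝_
    ; isPreorder = ReflClosure.isPreorder λ { w↝u () }
    ; w          = w
    ; U          = Unrestricted
    ; U-upward   = λ { refl p → p ; (step w↝u) () }
    }

open Signature-l public using (l)
open Signature-ll public using (ll)

record Atoms : Set₁ where
  field
    Pos Neg : Set

_⊎ᴬ_ : Atoms → Atoms → Atoms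
A ⊎ᴬ B = record { Pos = A.Pos ⊎ B.Pos ; Neg = A.Neg ⊎ B.Neg }
  where module A = Atoms A
        module B = Atoms B

data Logic : Set where
  classical intuitionistic : Logic

module Formulas (Z : Set) (A : Atoms) where
  open Atoms A

  mutual
    data Positive : Logic → Set where
      atom    : ∀ {L} → Pos → Positive L
      _⊗_ _⊕_ : ∀ {L} → Positive L → Positive L → Positive L
      𝟏 𝟎     : ∀ {L} → Positive L
      ![_]_   : ∀ {L} → Z → Ň L → Positive L

    data Negative : Logic → Set where
      atom  : ∀ {L} → Neg → Negative L
      _&_   : ∀ {L} → Negative L → Negative L → Negative L
      top   : ∀ {L} → Negative L
      _⅋_   : Negative classical → Negative classical → Negative classical
      bot   : Negative classical
      _⊸_   : ∀ {L} → Positive L → Negative L → Negative L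
      ?[_]_ : ∀ {L} → Z → P̂ L → Negative L

    data P̂ : Logic → Set where
      pos  : ∀ {L} → Positive L → P̂ L
      atom : ∀ {L} → Neg → P̂ L

    data Ň : Logic → Set where
      neg  : ∀ {L} → Negative L → Ň L
      atom : ∀ {L} → Pos → Ň L

  -- Zoned formulas z:Ň (left passive) and z:P̂ (right passive).
  LeftZoned RightZoned : Logic → Set
  LeftZoned  L = Z × Ň L
  RightZoned L = Z × P̂ L

-- Multisets of occurrences are represented by lists, an occurrence being a
-- membership proof: equal formulas at different positions are different
-- occurrences. Rules apply at any position, so that no exchange rule is needed.
module Zoning (Σ : Signature) where
  open Signature Σ

  AllUnrestricted : ∀ {F : Set} → List (Z × F) → Set
  AllUnrestricted = All (U ∘ proj₁)

  _≤*_ : ∀ {F : Set} → Z → List (Z × F) → Set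
  z ≤* Γ = All (λ x → z ≤ proj₁ x) Γ

  -- Split Γ Γ₁ Γ₂: for some decomposition of Γ into Γᵘ, Γʳ₁, Γʳ₂, the contexts
  -- Γ₁ and Γ₂ are Γᵘ, Γʳ₁ and Γᵘ, Γʳ₂. Side conditions are irrelevant here and
  -- in the calculi, so that they do not multiply derivations.
  data Split {F : Set} : (Γ Γ₁ Γ₂ : List (Z × F)) → Set where
    []     : Split [] [] []
    share  : ∀ {z f Γ Γ₁ Γ₂} → .(U z) → Split Γ Γ₁ Γ₂ →
             Split ((z , f) ∷ Γ) ((z , f) ∷ Γ₁) ((z , f) ∷ Γ₂)
    first  : ∀ {z f Γ Γ₁ Γ₂} → .(¬ U z) → Split Γ Γ₁ Γ₂ →
             Split ((z , f) ∷ Γ) ((z , f) ∷ Γ₁) Γ₂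
    second : ∀ {z f Γ Γ₁ Γ₂} → .(¬ U z) → Split Γ Γ₁ Γ₂ →
             Split ((z , f) ∷ Γ) Γ₁ ((z , f) ∷ Γ₂)

-- In both calculi:
--
-- * The constructor `open-leaf` stands for an open premise, which is a neutral
--   sequent. Decision rules only occur as the last rule of a `Synthetic`
--   derivation.
--
-- * The relation _≈_ identifies derivations that differ only in the way the
--   active rules are applied: it requires the focus and decision rules, and the
--   occurrences these act on, to be the same, and relates any two derivations of
--   the same active sequent. (The active rules are invertible and permute with
--   one another, so two derivations of an active sequent, all of whose open
--   leaves are neutral, have the same open leaves up to permutation.)

module CSL (Σ : Signature) (A : Atoms) where
  open Signature Σ
  open Formulas Z A
  open Zoning Σ

  Left Right : Set
  Left  = LeftZoned classical
  Right = RightZoned classical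

  Neutral : Set
  Neutral = List Left × List Right

  mutual
    -- RightFocus Γ P Δ is Γ ⊢ [P] ; Δ
    data RightFocus : List Left → Positive classical → List Right → Set where
      init : ∀ {Γ Δ z p} (i : (z , atom p) ∈ Γ) →
             .(AllUnrestricted (Γ ─ i)) → .(AllUnrestricted Δ) →
             RightFocus Γ (atom p) Δ
      ⊗R   : ∀ {Γ Γ₁ Γ₂ Δ Δ₁ Δ₂ P Q} → Split Γ Γ₁ Γ₂ → Split Δ Δ₁ Δ₂ →
             RightFocus Γ₁ P Δ₁ → RightFocus Γ₂ Q Δ₂ → RightFocus Γ (P ⊗ Q) Δ
      𝟏R   : ∀ {Γ Δ} → .(AllUnrestricted Γ) → .(AllUnrestricted Δ) →
             RightFocus Γ 𝟏 Δ
      ⊕R₁  : ∀ {Γ Δ P Q} → RightFocus Γ P Δ → RightFocus Γ (P ⊕ Q) Δ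
      ⊕R₂  : ∀ {Γ Δ P Q} → RightFocus Γ Q Δ → RightFocus Γ (P ⊕ Q) Δ
      !R   : ∀ {Γ Δ z N} → .(z ≤* Γ) → .(z ≤* Δ) →
             Active Γ [] [ N ] Δ → RightFocus Γ (![ z ] N) Δ

    -- LeftFocus Γ N Δ is Γ ; [N] ⊢ Δ
    data LeftFocus : List Left → Negative classical → List Right → Set where
      init : ∀ {Γ Δ z n} (i : (z , atom n) ∈ Δ) →
             .(AllUnrestricted Γ) → .(AllUnrestricted (Δ ─ i)) →
             LeftFocus Γ (atom n) Δ
      &L₁  : ∀ {Γ Δ N M} → LeftFocus Γ N Δ → LeftFocus Γ (N & M) Δ
      &L₂  : ∀ {Γ Δ N M} → LeftFocus Γ M Δ → LeftFocus Γ (N & M) Δ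
      ⅋L   : ∀ {Γ Γ₁ Γ₂ Δ Δ₁ Δ₂ N M} → Split Γ Γ₁ Γ₂ → Split Δ Δ₁ Δ₂ →
             LeftFocus Γ₁ N Δ₁ → LeftFocus Γ₂ M Δ₂ → LeftFocus Γ (N ⅋ M) Δ
      botL : ∀ {Γ Δ} → .(AllUnrestricted Γ) → .(AllUnrestricted Δ) →
             LeftFocus Γ bot Δ
      ⊸L   : ∀ {Γ Γ₁ Γ₂ Δ Δ₁ Δ₂ P M} → Split Γ Γ₁ Γ₂ → Split Δ Δ₁ Δ₂ →
             RightFocus Γ₁ P Δ₁ → LeftFocus Γ₂ M Δ₂ → LeftFocus Γ (P ⊸ M) Δ
      ?L   : ∀ {Γ Δ z P} → .(z ≤* Γ) → .(z ≤* Δ) →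
             Active Γ [ P ] [] Δ → LeftFocus Γ (?[ z ] P) Δ

    -- Active Γ Ω Ξ Δ is Γ ; Ω ⊢ Ξ ; Δ
    data Active : List Left → List (P̂ classical) →
                  List (Ň classical) → List Right → Set where
      open-leaf : ∀ {Γ Δ} → Active Γ [] [] Δ

      atom⁺R : ∀ {Γ Ω Ξ Δ p} (i : atom p ∈ Ξ) →
               Active Γ Ω (Ξ ─ i) ((w , pos (atom p)) ∷ Δ) → Active Γ Ω Ξ Δ
      atom⁻R : ∀ {Γ Ω Ξ Δ n} (i : neg (atom n) ∈ Ξ) →
               Active Γ Ω (Ξ ─ i) ((w , atom n) ∷ Δ) → Active Γ Ω Ξ Δ
      &R     : ∀ {Γ Ω Ξ Δ N M} (i : neg (N & M) ∈ Ξ) →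
               Active Γ Ω (neg N ∷ (Ξ ─ i)) Δ →
               Active Γ Ω (neg M ∷ (Ξ ─ i)) Δ → Active Γ Ω Ξ Δ
      topR   : ∀ {Γ Ω Ξ Δ} → neg top ∈ Ξ → Active Γ Ω Ξ Δ
      ⅋R     : ∀ {Γ Ω Ξ Δ N M} (i : neg (N ⅋ M) ∈ Ξ) →
               Active Γ Ω (neg N ∷ neg M ∷ (Ξ ─ i)) Δ → Active Γ Ω Ξ Δ
      botR   : ∀ {Γ Ω Ξ Δ} (i : neg bot ∈ Ξ) →
               Active Γ Ω (Ξ ─ i) Δ → Active Γ Ω Ξ Δ
      ⊸R     : ∀ {Γ Ω Ξ Δ P N} (i : neg (P ⊸ N) ∈ Ξ) →
               Active Γ (pos P ∷ Ω) (neg N ∷ (Ξ ─ i)) Δ → Active Γ Ω Ξ Δ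
      ?R     : ∀ {Γ Ω Ξ Δ z P} (i : neg (?[ z ] P) ∈ Ξ) →
               Active Γ Ω (Ξ ─ i) ((z , P) ∷ Δ) → Active Γ Ω Ξ Δ

      atom⁺L : ∀ {Γ Ω Ξ Δ p} (i : pos (atom p) ∈ Ω) →
               Active ((w , atom p) ∷ Γ) (Ω ─ i) Ξ Δ → Active Γ Ω Ξ Δ
      atom⁻L : ∀ {Γ Ω Ξ Δ n} (i : atom n ∈ Ω) →
               Active ((w , neg (atom n)) ∷ Γ) (Ω ─ i) Ξ Δ → Active Γ Ω Ξ Δ
      ⊗L     : ∀ {Γ Ω Ξ Δ P Q} (i : pos (P ⊗ Q) ∈ Ω) →
               Active Γ (pos P ∷ pos Q ∷ (Ω ─ i)) Ξ Δ → Active Γ Ω Ξ Δ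
      𝟏L     : ∀ {Γ Ω Ξ Δ} (i : pos 𝟏 ∈ Ω) →
               Active Γ (Ω ─ i) Ξ Δ → Active Γ Ω Ξ Δ
      ⊕L     : ∀ {Γ Ω Ξ Δ P Q} (i : pos (P ⊕ Q) ∈ Ω) →
               Active Γ (pos P ∷ (Ω ─ i)) Ξ Δ →
               Active Γ (pos Q ∷ (Ω ─ i)) Ξ Δ → Active Γ Ω Ξ Δ
      𝟎L     : ∀ {Γ Ω Ξ Δ} → pos 𝟎 ∈ Ω → Active Γ Ω Ξ Δ
      !L     : ∀ {Γ Ω Ξ Δ z N} (i : pos (![ z ] N) ∈ Ω) →
               Active ((z , N) ∷ Γ) (Ω ─ i) Ξ Δ → Active Γ Ω Ξ Δ

  data Synthetic : Neutral → Set where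
    decideʳR : ∀ {Γ Δ r P} (i : (r , pos P) ∈ Δ) → .(¬ U r) →
               RightFocus Γ P (Δ ─ i) → Synthetic (Γ , Δ)
    decideᵘR : ∀ {Γ Δ u P} → (u , pos P) ∈ Δ → .(U u) →
               RightFocus Γ P Δ → Synthetic (Γ , Δ)
    decideʳL : ∀ {Γ Δ r N} (i : (r , neg N) ∈ Γ) → .(¬ U r) →
               LeftFocus (Γ ─ i) N Δ → Synthetic (Γ , Δ)
    decideᵘL : ∀ {Γ Δ u N} → (u , neg N) ∈ Γ → .(U u) →
               LeftFocus Γ N Δ → Synthetic (Γ , Δ)

  mutual
    premisesR : ∀ {Γ P Δ} → RightFocus Γ P Δ → List Neutral
    premisesR (init _ _ _)   = []
    premisesR (⊗R _ _ d e)   = premisesR d ++ premisesR e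
    premisesR (𝟏R _ _)       = []
    premisesR (⊕R₁ d)        = premisesR d
    premisesR (⊕R₂ d)        = premisesR d
    premisesR (!R _ _ d)     = premisesA d

    premisesL : ∀ {Γ N Δ} → LeftFocus Γ N Δ → List Neutral
    premisesL (init _ _ _)   = []
    premisesL (&L₁ d)        = premisesL d
    premisesL (&L₂ d)        = premisesL d
    premisesL (⅋L _ _ d e)   = premisesL d ++ premisesL e
    premisesL (botL _ _)     = []
    premisesL (⊸L _ _ d e)   = premisesR d ++ premisesL e
    premisesL (?L _ _ d)     = premisesA d

    premisesA : ∀ {Γ Ω Ξ Δ} → Active Γ Ω Ξ Δ → List Neutral
    premisesA {Γ} {Δ = Δ} open-leaf = [ (Γ , Δ) ]
    premisesA (atom⁺R _ d)   = premisesA d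
    premisesA (atom⁻R _ d)   = premisesA d
    premisesA (&R _ d e)     = premisesA d ++ premisesA e
    premisesA (topR _)       = []
    premisesA (⅋R _ d)       = premisesA d
    premisesA (botR _ d)     = premisesA d
    premisesA (⊸R _ d)       = premisesA d
    premisesA (?R _ d)       = premisesA d
    premisesA (atom⁺L _ d)   = premisesA d
    premisesA (atom⁻L _ d)   = premisesA d
    premisesA (⊗L _ d)       = premisesA d
    premisesA (𝟏L _ d)       = premisesA d
    premisesA (⊕L _ d e)     = premisesA d ++ premisesA e
    premisesA (𝟎L _)         = []
    premisesA (!L _ d)       = premisesA d

  premises : ∀ {S} → Synthetic S → List Neutral
  premises (decideʳR _ _ d) = premisesR d
  premises (decideᵘR _ _ d) = premisesR d
  premises (decideʳL _ _ d) = premisesL d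
  premises (decideᵘL _ _ d) = premisesL d

  data _≈R_ : ∀ {Γ P Δ} → Rel (RightFocus Γ P Δ) 0ℓ where
    init : ∀ {Γ Δ z p} {i : (z , atom p) ∈ Γ}
           .{a : AllUnrestricted (Γ ─ i)} .{b : AllUnrestricted Δ} →
           init {Δ = Δ} i a b ≈R init i a b
    ⊗R   : ∀ {Γ Γ₁ Γ₂ Δ Δ₁ Δ₂ P Q} {s : Split Γ Γ₁ Γ₂} {t : Split Δ Δ₁ Δ₂}
           {d d′ : RightFocus Γ₁ P Δ₁} {e e′ : RightFocus Γ₂ Q Δ₂} →
           d ≈R d′ → e ≈R e′ → ⊗R s t d e ≈R ⊗R s t d′ e′
    𝟏R   : ∀ {Γ Δ} .{a : AllUnrestricted Γ} .{b : AllUnrestricted Δ} →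
           𝟏R {Γ} {Δ} a b ≈R 𝟏R a b
    ⊕R₁  : ∀ {Γ Δ P Q} {d d′ : RightFocus Γ P Δ} →
           d ≈R d′ → ⊕R₁ {Q = Q} d ≈R ⊕R₁ d′
    ⊕R₂  : ∀ {Γ Δ P Q} {d d′ : RightFocus Γ Q Δ} →
           d ≈R d′ → ⊕R₂ {P = P} d ≈R ⊕R₂ d′
    !R   : ∀ {Γ Δ z N} .{a : z ≤* Γ} .{b : z ≤* Δ} {d d′ : Active Γ [] [ N ] Δ} →
           !R a b d ≈R !R a b d′

  data _≈L_ : ∀ {Γ N Δ} → Rel (LeftFocus Γ N Δ) 0ℓ where
    init : ∀ {Γ Δ z n} {i : (z , atom n) ∈ Δ}
           .{a : AllUnrestricted Γ} .{b : AllUnrestricted (Δ ─ i)} →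
           init {Γ} i a b ≈L init i a b
    &L₁  : ∀ {Γ Δ N M} {d d′ : LeftFocus Γ N Δ} →
           d ≈L d′ → &L₁ {M = M} d ≈L &L₁ d′
    &L₂  : ∀ {Γ Δ N M} {d d′ : LeftFocus Γ M Δ} →
           d ≈L d′ → &L₂ {N = N} d ≈L &L₂ d′
    ⅋L   : ∀ {Γ Γ₁ Γ₂ Δ Δ₁ Δ₂ N M} {s : Split Γ Γ₁ Γ₂} {t : Split Δ Δ₁ Δ₂}
           {d d′ : LeftFocus Γ₁ N Δ₁} {e e′ : LeftFocus Γ₂ M Δ₂} →
           d ≈L d′ → e ≈L e′ → ⅋L s t d e ≈L ⅋L s t d′ e′
    botL : ∀ {Γ Δ} .{a : AllUnrestricted Γ} .{b : AllUnrestricted Δ} →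
           botL {Γ} {Δ} a b ≈L botL a b
    ⊸L   : ∀ {Γ Γ₁ Γ₂ Δ Δ₁ Δ₂ P M} {s : Split Γ Γ₁ Γ₂} {t : Split Δ Δ₁ Δ₂}
           {d d′ : RightFocus Γ₁ P Δ₁} {e e′ : LeftFocus Γ₂ M Δ₂} →
           d ≈R d′ → e ≈L e′ → ⊸L s t d e ≈L ⊸L s t d′ e′
    ?L   : ∀ {Γ Δ z P} .{a : z ≤* Γ} .{b : z ≤* Δ} {d d′ : Active Γ [ P ] [] Δ} →
           ?L a b d ≈L ?L a b d′

  data _≈_ : ∀ {S} → Rel (Synthetic S) 0ℓ where
    decideʳR : ∀ {Γ Δ r P} {i : (r , pos P) ∈ Δ} .{a : ¬ U r}
               {d d′ : RightFocus Γ P (Δ ─ i)} →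
               d ≈R d′ → decideʳR i a d ≈ decideʳR i a d′
    decideᵘR : ∀ {Γ Δ u P} {i : (u , pos P) ∈ Δ} .{a : U u}
               {d d′ : RightFocus Γ P Δ} →
               d ≈R d′ → decideᵘR i a d ≈ decideᵘR i a d′
    decideʳL : ∀ {Γ Δ r N} {i : (r , neg N) ∈ Γ} .{a : ¬ U r}
               {d d′ : LeftFocus (Γ ─ i) N Δ} →
               d ≈L d′ → decideʳL i a d ≈ decideʳL i a d′
    decideᵘL : ∀ {Γ Δ u N} {i : (u , neg N) ∈ Γ} .{a : U u}
               {d d′ : LeftFocus Γ N Δ} →
               d ≈L d′ → decideᵘL i a d ≈ decideᵘL i a d′

  ≈R-refl : ∀ {Γ P Δ} {d : RightFocus Γ P Δ} → d ≈R d
  ≈R-refl {d = init _ _ _} = init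
  ≈R-refl {d = ⊗R _ _ _ _} = ⊗R ≈R-refl ≈R-refl
  ≈R-refl {d = 𝟏R _ _}     = 𝟏R
  ≈R-refl {d = ⊕R₁ _}      = ⊕R₁ ≈R-refl
  ≈R-refl {d = ⊕R₂ _}      = ⊕R₂ ≈R-refl
  ≈R-refl {d = !R _ _ _}   = !R

  ≈R-sym : ∀ {Γ P Δ} {d e : RightFocus Γ P Δ} → d ≈R e → e ≈R d
  ≈R-sym init     = init
  ≈R-sym (⊗R p q) = ⊗R (≈R-sym p) (≈R-sym q)
  ≈R-sym 𝟏R       = 𝟏R
  ≈R-sym (⊕R₁ p)  = ⊕R₁ (≈R-sym p)
  ≈R-sym (⊕R₂ p)  = ⊕R₂ (≈R-sym p)
  ≈R-sym !R       = !R

  ≈R-trans : ∀ {Γ P Δ} {d e f : RightFocus Γ P Δ} → d ≈R e → e ≈R f → d ≈R f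
  ≈R-trans init     init       = init
  ≈R-trans (⊗R p q) (⊗R p′ q′) = ⊗R (≈R-trans p p′) (≈R-trans q q′)
  ≈R-trans 𝟏R       𝟏R         = 𝟏R
  ≈R-trans (⊕R₁ p)  (⊕R₁ p′)   = ⊕R₁ (≈R-trans p p′)
  ≈R-trans (⊕R₂ p)  (⊕R₂ p′)   = ⊕R₂ (≈R-trans p p′)
  ≈R-trans !R       !R         = !R

  ≈L-refl : ∀ {Γ N Δ} {d : LeftFocus Γ N Δ} → d ≈L d
  ≈L-refl {d = init _ _ _} = init
  ≈L-refl {d = &L₁ _}      = &L₁ ≈L-refl
  ≈L-refl {d = &L₂ _}      = &L₂ ≈L-refl
  ≈L-refl {d = ⅋L _ _ _ _} = ⅋L ≈L-refl ≈L-refl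
  ≈L-refl {d = botL _ _}   = botL
  ≈L-refl {d = ⊸L _ _ _ _} = ⊸L ≈R-refl ≈L-refl
  ≈L-refl {d = ?L _ _ _}   = ?L

  ≈L-sym : ∀ {Γ N Δ} {d e : LeftFocus Γ N Δ} → d ≈L e → e ≈L d
  ≈L-sym init     = init
  ≈L-sym (&L₁ p)  = &L₁ (≈L-sym p)
  ≈L-sym (&L₂ p)  = &L₂ (≈L-sym p)
  ≈L-sym (⅋L p q) = ⅋L (≈L-sym p) (≈L-sym q)
  ≈L-sym botL     = botL
  ≈L-sym (⊸L p q) = ⊸L (≈R-sym p) (≈L-sym q)
  ≈L-sym ?L       = ?L

  ≈L-trans : ∀ {Γ N Δ} {d e f : LeftFocus Γ N Δ} → d ≈L e → e ≈L f → d ≈L f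
  ≈L-trans init     init       = init
  ≈L-trans (&L₁ p)  (&L₁ p′)   = &L₁ (≈L-trans p p′)
  ≈L-trans (&L₂ p)  (&L₂ p′)   = &L₂ (≈L-trans p p′)
  ≈L-trans (⅋L p q) (⅋L p′ q′) = ⅋L (≈L-trans p p′) (≈L-trans q q′)
  ≈L-trans botL     botL       = botL
  ≈L-trans (⊸L p q) (⊸L p′ q′) = ⊸L (≈R-trans p p′) (≈L-trans q q′)
  ≈L-trans ?L       ?L         = ?L

  ≈-refl : ∀ {S} {d : Synthetic S} → d ≈ d
  ≈-refl {d = decideʳR _ _ _} = decideʳR ≈R-refl
  ≈-refl {d = decideᵘR _ _ _} = decideᵘR ≈R-refl
  ≈-refl {d = decideʳL _ _ _} = decideʳL ≈L-refl
  ≈-refl {d = decideᵘL _ _ _} = decideᵘL ≈L-refl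

  ≈-sym : ∀ {S} {d e : Synthetic S} → d ≈ e → e ≈ d
  ≈-sym (decideʳR p) = decideʳR (≈R-sym p)
  ≈-sym (decideᵘR p) = decideᵘR (≈R-sym p)
  ≈-sym (decideʳL p) = decideʳL (≈L-sym p)
  ≈-sym (decideᵘL p) = decideᵘL (≈L-sym p)

  ≈-trans : ∀ {S} {d e f : Synthetic S} → d ≈ e → e ≈ f → d ≈ f
  ≈-trans (decideʳR p) (decideʳR q) = decideʳR (≈R-trans p q)
  ≈-trans (decideᵘR p) (decideᵘR q) = decideᵘR (≈R-trans p q)
  ≈-trans (decideʳL p) (decideʳL q) = decideʳL (≈L-trans p q)
  ≈-trans (decideᵘL p) (decideᵘL q) = decideᵘL (≈L-trans p q)

  syntheticSetoid : Neutral → Setoid 0ℓ 0ℓ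
  syntheticSetoid S = record
    { Carrier       = Synthetic S
    ; _≈_           = _≈_
    ; isEquivalence = record { refl = ≈-refl ; sym = ≈-sym ; trans = ≈-trans }
    }

  -- Equality of neutral sequents as pairs of multisets.
  _≋_ : Rel Neutral 0ℓ
  (Γ , Δ) ≋ (Γ′ , Δ′) = Γ ↭ Γ′ × Δ ↭ Δ′

module ISL (Σ : Signature) (A : Atoms) where
  open Signature Σ
  open Formulas Z A
  open Zoning Σ

  Left Right : Set
  Left  = LeftZoned intuitionistic
  Right = RightZoned intuitionistic

  Neutral : Set
  Neutral = List Left × Right

  -- The right-hand side of an active sequent: either Ň ; · or · ; z:Q̂.
  data Goal : Set where
    active  : Ň intuitionistic → Goal
    passive : Right → Goal

  mutual
    -- RightFocus Γ P is Γ ⊢ [P]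
    data RightFocus : List Left → Positive intuitionistic → Set where
      init : ∀ {Γ z p} (i : (z , atom p) ∈ Γ) →
             .(AllUnrestricted (Γ ─ i)) → RightFocus Γ (atom p)
      ⊗R   : ∀ {Γ Γ₁ Γ₂ P Q} → Split Γ Γ₁ Γ₂ →
             RightFocus Γ₁ P → RightFocus Γ₂ Q → RightFocus Γ (P ⊗ Q)
      𝟏R   : ∀ {Γ} → .(AllUnrestricted Γ) → RightFocus Γ 𝟏
      ⊕R₁  : ∀ {Γ P Q} → RightFocus Γ P → RightFocus Γ (P ⊕ Q)
      ⊕R₂  : ∀ {Γ P Q} → RightFocus Γ Q → RightFocus Γ (P ⊕ Q)
      !R   : ∀ {Γ z N} → .(z ≤* Γ) →
             Active Γ [] (active N) → RightFocus Γ (![ z ] N)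

    -- LeftFocus Γ N (z , Q) is Γ ; [N] ⊢ z:Q
    data LeftFocus : List Left → Negative intuitionistic → Right → Set where
      init : ∀ {Γ z n} → .(AllUnrestricted Γ) → LeftFocus Γ (atom n) (z , atom n)
      &L₁  : ∀ {Γ R N M} → LeftFocus Γ N R → LeftFocus Γ (N & M) R
      &L₂  : ∀ {Γ R N M} → LeftFocus Γ M R → LeftFocus Γ (N & M) R
      ⊸L   : ∀ {Γ Γ₁ Γ₂ R P M} → Split Γ Γ₁ Γ₂ →
             RightFocus Γ₁ P → LeftFocus Γ₂ M R → LeftFocus Γ (P ⊸ M) R
      ?L   : ∀ {Γ R z P} → .(z ≤* Γ) → .(z ≤ proj₁ R) →
             Active Γ [ P ] (passive R) → LeftFocus Γ (?[ z ] P) R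

    -- Active Γ Ω G is Γ ; Ω ⊢ G
    data Active : List Left → List (P̂ intuitionistic) → Goal → Set where
      open-leaf : ∀ {Γ R} → Active Γ [] (passive R)

      atom⁺R : ∀ {Γ Ω p} → Active Γ Ω (passive (w , pos (atom p))) →
               Active Γ Ω (active (atom p))
      atom⁻R : ∀ {Γ Ω n} → Active Γ Ω (passive (w , atom n)) →
               Active Γ Ω (active (neg (atom n)))
      &R     : ∀ {Γ Ω N M} → Active Γ Ω (active (neg N)) →
               Active Γ Ω (active (neg M)) → Active Γ Ω (active (neg (N & M)))
      topR   : ∀ {Γ Ω} → Active Γ Ω (active (neg top))
      ⊸R     : ∀ {Γ Ω P N} → Active Γ (pos P ∷ Ω) (active (neg N)) →
               Active Γ Ω (active (neg (P ⊸ N)))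
      ?R     : ∀ {Γ Ω z P} → Active Γ Ω (passive (z , P)) →
               Active Γ Ω (active (neg (?[ z ] P)))

      atom⁺L : ∀ {Γ Ω G p} (i : pos (atom p) ∈ Ω) →
               Active ((w , atom p) ∷ Γ) (Ω ─ i) G → Active Γ Ω G
      atom⁻L : ∀ {Γ Ω G n} (i : atom n ∈ Ω) →
               Active ((w , neg (atom n)) ∷ Γ) (Ω ─ i) G → Active Γ Ω G
      ⊗L     : ∀ {Γ Ω G P Q} (i : pos (P ⊗ Q) ∈ Ω) →
               Active Γ (pos P ∷ pos Q ∷ (Ω ─ i)) G → Active Γ Ω G
      𝟏L     : ∀ {Γ Ω G} (i : pos 𝟏 ∈ Ω) → Active Γ (Ω ─ i) G → Active Γ Ω G
      ⊕L     : ∀ {Γ Ω G P Q} (i : pos (P ⊕ Q) ∈ Ω) →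
               Active Γ (pos P ∷ (Ω ─ i)) G →
               Active Γ (pos Q ∷ (Ω ─ i)) G → Active Γ Ω G
      𝟎L     : ∀ {Γ Ω G} → pos 𝟎 ∈ Ω → Active Γ Ω G
      !L     : ∀ {Γ Ω G z N} (i : pos (![ z ] N) ∈ Ω) →
               Active ((z , N) ∷ Γ) (Ω ─ i) G → Active Γ Ω G

  data Synthetic : Neutral → Set where
    decideR  : ∀ {Γ z P} → RightFocus Γ P → Synthetic (Γ , (z , pos P))
    decideʳL : ∀ {Γ R r N} (i : (r , neg N) ∈ Γ) → .(¬ U r) →
               LeftFocus (Γ ─ i) N R → Synthetic (Γ , R)
    decideᵘL : ∀ {Γ R u N} → (u , neg N) ∈ Γ → .(U u) →
               LeftFocus Γ N R → Synthetic (Γ , R)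

  mutual
    premisesR : ∀ {Γ P} → RightFocus Γ P → List Neutral
    premisesR (init _ _)   = []
    premisesR (⊗R _ d e)   = premisesR d ++ premisesR e
    premisesR (𝟏R _)       = []
    premisesR (⊕R₁ d)      = premisesR d
    premisesR (⊕R₂ d)      = premisesR d
    premisesR (!R _ d)     = premisesA d

    premisesL : ∀ {Γ N R} → LeftFocus Γ N R → List Neutral
    premisesL (init _)     = []
    premisesL (&L₁ d)      = premisesL d
    premisesL (&L₂ d)      = premisesL d
    premisesL (⊸L _ d e)   = premisesR d ++ premisesL e
    premisesL (?L _ _ d)   = premisesA d

    premisesA : ∀ {Γ Ω G} → Active Γ Ω G → List Neutral
    premisesA (open-leaf {Γ} {R}) = [ (Γ , R) ]
    premisesA (atom⁺R d)   = premisesA d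
    premisesA (atom⁻R d)   = premisesA d
    premisesA (&R d e)     = premisesA d ++ premisesA e
    premisesA topR         = []
    premisesA (⊸R d)       = premisesA d
    premisesA (?R d)       = premisesA d
    premisesA (atom⁺L _ d) = premisesA d
    premisesA (atom⁻L _ d) = premisesA d
    premisesA (⊗L _ d)     = premisesA d
    premisesA (𝟏L _ d)     = premisesA d
    premisesA (⊕L _ d e)   = premisesA d ++ premisesA e
    premisesA (𝟎L _)       = []
    premisesA (!L _ d)     = premisesA d

  premises : ∀ {S} → Synthetic S → List Neutral
  premises (decideR d)      = premisesR d
  premises (decideʳL _ _ d) = premisesL d
  premises (decideᵘL _ _ d) = premisesL d

  data _≈R_ : ∀ {Γ P} → Rel (RightFocus Γ P) 0ℓ where
    init : ∀ {Γ z p} {i : (z , atom p) ∈ Γ} .{a : AllUnrestricted (Γ ─ i)} →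
           init i a ≈R init i a
    ⊗R   : ∀ {Γ Γ₁ Γ₂ P Q} {s : Split Γ Γ₁ Γ₂}
           {d d′ : RightFocus Γ₁ P} {e e′ : RightFocus Γ₂ Q} →
           d ≈R d′ → e ≈R e′ → ⊗R s d e ≈R ⊗R s d′ e′
    𝟏R   : ∀ {Γ} .{a : AllUnrestricted Γ} → 𝟏R {Γ} a ≈R 𝟏R a
    ⊕R₁  : ∀ {Γ P Q} {d d′ : RightFocus Γ P} →
           d ≈R d′ → ⊕R₁ {Q = Q} d ≈R ⊕R₁ d′
    ⊕R₂  : ∀ {Γ P Q} {d d′ : RightFocus Γ Q} →
           d ≈R d′ → ⊕R₂ {P = P} d ≈R ⊕R₂ d′
    !R   : ∀ {Γ z N} .{a : z ≤* Γ} {d d′ : Active Γ [] (active N)} →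
           !R a d ≈R !R a d′

  data _≈L_ : ∀ {Γ N R} → Rel (LeftFocus Γ N R) 0ℓ where
    init : ∀ {Γ z n} .{a : AllUnrestricted Γ} →
           init {Γ} {z} {n} a ≈L init a
    &L₁  : ∀ {Γ R N M} {d d′ : LeftFocus Γ N R} →
           d ≈L d′ → &L₁ {M = M} d ≈L &L₁ d′
    &L₂  : ∀ {Γ R N M} {d d′ : LeftFocus Γ M R} →
           d ≈L d′ → &L₂ {N = N} d ≈L &L₂ d′
    ⊸L   : ∀ {Γ Γ₁ Γ₂ R P M} {s : Split Γ Γ₁ Γ₂}
           {d d′ : RightFocus Γ₁ P} {e e′ : LeftFocus Γ₂ M R} →
           d ≈R d′ → e ≈L e′ → ⊸L s d e ≈L ⊸L s d′ e′
    ?L   : ∀ {Γ R z P} .{a : z ≤* Γ} .{b : z ≤ proj₁ R}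
           {d d′ : Active Γ [ P ] (passive R)} →
           ?L a b d ≈L ?L a b d′

  data _≈_ : ∀ {S} → Rel (Synthetic S) 0ℓ where
    decideR  : ∀ {Γ z P} {d d′ : RightFocus Γ P} →
               d ≈R d′ → decideR {z = z} d ≈ decideR d′
    decideʳL : ∀ {Γ R r N} {i : (r , neg N) ∈ Γ} .{a : ¬ U r}
               {d d′ : LeftFocus (Γ ─ i) N R} →
               d ≈L d′ → decideʳL i a d ≈ decideʳL i a d′
    decideᵘL : ∀ {Γ R u N} {i : (u , neg N) ∈ Γ} .{a : U u}
               {d d′ : LeftFocus Γ N R} →
               d ≈L d′ → decideᵘL i a d ≈ decideᵘL i a d′

  ≈R-refl : ∀ {Γ P} {d : RightFocus Γ P} → d ≈R d
  ≈R-refl {d = init _ _} = init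
  ≈R-refl {d = ⊗R _ _ _} = ⊗R ≈R-refl ≈R-refl
  ≈R-refl {d = 𝟏R _}     = 𝟏R
  ≈R-refl {d = ⊕R₁ _}    = ⊕R₁ ≈R-refl
  ≈R-refl {d = ⊕R₂ _}    = ⊕R₂ ≈R-refl
  ≈R-refl {d = !R _ _}   = !R

  ≈R-sym : ∀ {Γ P} {d e : RightFocus Γ P} → d ≈R e → e ≈R d
  ≈R-sym init     = init
  ≈R-sym (⊗R p q) = ⊗R (≈R-sym p) (≈R-sym q)
  ≈R-sym 𝟏R       = 𝟏R
  ≈R-sym (⊕R₁ p)  = ⊕R₁ (≈R-sym p)
  ≈R-sym (⊕R₂ p)  = ⊕R₂ (≈R-sym p)
  ≈R-sym !R       = !R

  ≈R-trans : ∀ {Γ P} {d e f : RightFocus Γ P} → d ≈R e → e ≈R f → d ≈R f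
  ≈R-trans init     init       = init
  ≈R-trans (⊗R p q) (⊗R p′ q′) = ⊗R (≈R-trans p p′) (≈R-trans q q′)
  ≈R-trans 𝟏R       𝟏R         = 𝟏R
  ≈R-trans (⊕R₁ p)  (⊕R₁ p′)   = ⊕R₁ (≈R-trans p p′)
  ≈R-trans (⊕R₂ p)  (⊕R₂ p′)   = ⊕R₂ (≈R-trans p p′)
  ≈R-trans !R       !R         = !R

  ≈L-refl : ∀ {Γ N R} {d : LeftFocus Γ N R} → d ≈L d
  ≈L-refl {d = init _}   = init
  ≈L-refl {d = &L₁ _}    = &L₁ ≈L-refl
  ≈L-refl {d = &L₂ _}    = &L₂ ≈L-refl
  ≈L-refl {d = ⊸L _ _ _} = ⊸L ≈R-refl ≈L-refl
  ≈L-refl {d = ?L _ _ _} = ?L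

  ≈L-sym : ∀ {Γ N R} {d e : LeftFocus Γ N R} → d ≈L e → e ≈L d
  ≈L-sym init     = init
  ≈L-sym (&L₁ p)  = &L₁ (≈L-sym p)
  ≈L-sym (&L₂ p)  = &L₂ (≈L-sym p)
  ≈L-sym (⊸L p q) = ⊸L (≈R-sym p) (≈L-sym q)
  ≈L-sym ?L       = ?L

  ≈L-trans : ∀ {Γ N R} {d e f : LeftFocus Γ N R} → d ≈L e → e ≈L f → d ≈L f
  ≈L-trans init     init       = init
  ≈L-trans (&L₁ p)  (&L₁ p′)   = &L₁ (≈L-trans p p′)
  ≈L-trans (&L₂ p)  (&L₂ p′)   = &L₂ (≈L-trans p p′)
  ≈L-trans (⊸L p q) (⊸L p′ q′) = ⊸L (≈R-trans p p′) (≈L-trans q q′)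
  ≈L-trans ?L       ?L         = ?L

  ≈-refl : ∀ {S} {d : Synthetic S} → d ≈ d
  ≈-refl {d = decideR _}      = decideR ≈R-refl
  ≈-refl {d = decideʳL _ _ _} = decideʳL ≈L-refl
  ≈-refl {d = decideᵘL _ _ _} = decideᵘL ≈L-refl

  ≈-sym : ∀ {S} {d e : Synthetic S} → d ≈ e → e ≈ d
  ≈-sym (decideR p)  = decideR (≈R-sym p)
  ≈-sym (decideʳL p) = decideʳL (≈L-sym p)
  ≈-sym (decideᵘL p) = decideᵘL (≈L-sym p)

  ≈-trans : ∀ {S} {d e f : Synthetic S} → d ≈ e → e ≈ f → d ≈ f
  ≈-trans (decideR p)  (decideR q)  = decideR (≈R-trans p q)
  ≈-trans (decideʳL p) (decideʳL q) = decideʳL (≈L-trans p q)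
  ≈-trans (decideᵘL p) (decideᵘL q) = decideᵘL (≈L-trans p q)

  syntheticSetoid : Neutral → Setoid 0ℓ 0ℓ
  syntheticSetoid S = record
    { Carrier       = Synthetic S
    ; _≈_           = _≈_
    ; isEquivalence = record { refl = ≈-refl ; sym = ≈-sym ; trans = ≈-trans }
    }

module _ (Σ₁ : Signature) (A₁ : Atoms) (Σ₂ : Signature) (A₂ : Atoms) where
  private
    module I = ISL Σ₁ A₁
    module C = CSL Σ₂ A₂

  -- Each zoned formula is translated to one zoned formula, which may be placed on
  -- the left (inj₁) or on the right (inj₂), whatever the side of the original.
  record Encoding : Set where
    field
      extra   : Maybe (C.Left ⊎ C.Right)
      onLeft  : I.Left → C.Left ⊎ C.Right
      onRight : I.Right → C.Left ⊎ C.Right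

    encode : I.Neutral → C.Neutral
    encode (Γ , R) = partitionSums (fromMaybe extra ++ onRight R ∷ map onLeft Γ)

module _ {Σ₁ : Signature} {A₁ : Atoms} {Σ₂ : Signature} {A₂ : Atoms} where
  private
    module I = ISL Σ₁ A₁
    module C = CSL Σ₂ A₂

  FocallyAdequate : Encoding Σ₁ A₁ Σ₂ A₂ → Set
  FocallyAdequate E =
    ∀ S → Σ[ f ∈ Inverse (I.syntheticSetoid S) (C.syntheticSetoid (encode S)) ]
          (∀ d → Permutation C._≋_ (C.premises (Inverse.to f d))
                                   (map encode (I.premises d)))
    where open Encoding E

-- Left formulas go to the unrestricted zone, so that they may be copied and
-- discarded, and the right formula goes to the linear zone w, so that there is
-- always exactly one. The translation depends on the side only at the atoms:
-- decomposing an atom on the left would store it in the zone w, so there an atom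
-- a becomes !ᵤ a, which stores it in the zone u; in focus on the right, p must
-- stay p, since !ᵤ p would end the phase. The only further freedom in the target
-- is to send the right formula to the first premise of ⊸L. This is never possible,
-- since a phase focused on the right ends with an initial rule, 𝟏 or !ᵤ, none of
-- which tolerates a formula in zone w on the right.
module Submission where

open import Defs
open import Data.Empty using (⊥; ⊥-elim; ⊥-elim-irr)
open import Data.Fin.Properties using (suc-injective)
open import Data.List.Base using (List; []; _∷_; [_]; _++_; map; partitionSums)
open import Data.List.Membership.Propositional using (_∈_)
open import Data.List.Membership.Propositional.Properties using (∈-map⁺)
open import Data.List.Properties using (map-++; map-cong)
import Data.List.Relation.Binary.Permutation.Homogeneous as Permutation
open import Data.List.Relation.Binary.Permutation.Propositional using (↭-refl)
import Data.List.Relation.Binary.Pointwise as Pointwise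
open import Data.List.Relation.Unary.All using ([]; _∷_)
import Data.List.Relation.Unary.All as All
import Data.List.Relation.Unary.All.Properties as All
open import Data.List.Relation.Unary.Any using (here; there; index; _─_)
open import Data.Maybe.Base using (nothing)
import Data.Product.Base as Product
open import Data.Product.Base using (_×_; _,_; proj₁; proj₂; ∃; Σ-syntax)
open import Data.Sum.Base using (inj₁; inj₂)
open import Function.Base using (_∘_; id)
open import Function.Bundles using (Inverse)
open import Level using (0ℓ)
open import Relation.Binary.Bundles using (Setoid)
open import Relation.Binary.Construct.Closure.Reflexive using (refl)
  renaming ([_] to step)
open import Relation.Binary.PropositionalEquality
  using (_≡_; refl; sym; trans; cong; cong₂; subst)
open import Relation.Nullary.Negation.Core using (¬_)

-- Occurrences in mapped lists.

module _ {A B : Set} (f : A → B) where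

  map-─ : ∀ {x xs} (i : x ∈ xs) → map f (xs ─ i) ≡ (map f xs ─ ∈-map⁺ f i)
  map-─ (here refl)            = refl
  map-─ {xs = y ∷ _} (there i) = cong (f y ∷_) (map-─ i)

  -- Occurrences are compared by position because the elements cannot be recovered from their
  -- images: `onLeft` is not injective, as `p̂ left` sends `pos (atom p)` and `pos (![ w ] atom p)`
  -- to the same formula.
  ∈-map⁺-index-injective : ∀ {x y xs} (i : x ∈ xs) (j : y ∈ xs) →
    index (∈-map⁺ f i) ≡ index (∈-map⁺ f j) → _≡_ {A = ∃ (_∈ xs)} (x , i) (y , j)
  ∈-map⁺-index-injective (here refl) (here refl) _ = refl
  ∈-map⁺-index-injective (there i)   (there j)   e
    with refl ← ∈-map⁺-index-injective i j (suc-injective e) = refl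

  ∈-map⁺-surjective : ∀ {y} xs (i : y ∈ map f xs) →
    Σ[ x ∈ A ] Σ[ j ∈ x ∈ xs ] Σ[ e ∈ f x ≡ y ] subst (_∈ map f xs) e (∈-map⁺ f j) ≡ i
  ∈-map⁺-surjective (x ∷ xs) (here refl) = x , here refl , refl , refl
  ∈-map⁺-surjective (x ∷ xs) (there i)
    with y , j , refl , refl ← ∈-map⁺-surjective xs i = y , there j , refl , refl

partitionSums-map-inj₁ : {X A B : Set} (f : X → A) (xs : List X) →
  partitionSums {A = A} {B = B} (map (inj₁ ∘ f) xs) ≡ (map f xs , [])
partitionSums-map-inj₁ f []       = refl
partitionSums-map-inj₁ f (x ∷ xs) = cong (Product.map₁ (f x ∷_)) (partitionSums-map-inj₁ f xs)

-- Inverses from bijections of setoids.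

module _ {S T : Setoid 0ℓ 0ℓ} where
  private
    module S = Setoid S
    module T = Setoid T

  -- The inverse picks the given preimages; injectivity moves each of its laws to the target, where
  -- `to-from` settles it.
  bijection⇒inverse : (to : S.Carrier → T.Carrier) →
    (∀ {x y} → x S.≈ y → to x T.≈ to y) →
    (∀ x y → to x T.≈ to y → x S.≈ y) →
    (∀ y → Σ[ x ∈ S.Carrier ] to x T.≈ y) →
    Inverse S T
  bijection⇒inverse to to-cong injective surjective = record
    { to        = to
    ; from      = from
    ; to-cong   = to-cong
    ; from-cong = λ y≈z → injective _ _
        (T.trans (to-from _) (T.trans y≈z (T.sym (to-from _))))
    ; inverse   = (λ x≈from → T.trans (to-cong x≈from) (to-from _))
                , (λ y≈to → injective _ _ (T.trans (to-from _) y≈to))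
    }
    where
    from : T.Carrier → S.Carrier
    from y = proj₁ (surjective y)
    to-from : ∀ y → to (from y) T.≈ y
    to-from y = proj₂ (surjective y)

-- Splitting unrestricted contexts.

module _ {Σ : Signature} where
  open Signature Σ
  open Zoning Σ

  share-all : ∀ {F} {Γ : List (Z × F)} → .(AllUnrestricted Γ) → Split Γ Γ Γ
  share-all {Γ = []}    _ = []
  share-all {Γ = _ ∷ _} a = share (All.head a) (share-all (All.tail a))

  -- A view: matching on `shares-all` identifies both parts of the split with `Γ` and the split
  -- itself with `share-all`.
  data SharesAll {F} {Γ : List (Z × F)} : ∀ {Γ₁ Γ₂} → Split Γ Γ₁ Γ₂ → Set where
    shares-all : .{a : AllUnrestricted Γ} → SharesAll (share-all a)

  sharesAll : ∀ {F} {Γ Γ₁ Γ₂ : List (Z × F)} → .(AllUnrestricted Γ) →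
              (s : Split Γ Γ₁ Γ₂) → SharesAll s
  sharesAll a []           = shares-all {a = []}
  sharesAll a (share x s) with shares-all ← sharesAll (All.tail a) s = shares-all {a = a}
  sharesAll a (first x s)  = ⊥-elim-irr (x (All.head a))
  sharesAll a (second x s) = ⊥-elim-irr (x (All.head a))

module _ (A : Atoms) where

  noAtoms : Atoms
  noAtoms = record { Pos = ⊥ ; Neg = ⊥ }

  private
    module I = ISL l A
    module C = CSL ll (A ⊎ᴬ noAtoms)
    module FI = Formulas Signature-l.Zone A
    module FC = Formulas Signature-ll.Zone (A ⊎ᴬ noAtoms)
  open Signature-l using (w)
  open Signature-ll using (w; u; w↝u; Unrestricted)
  open Zoning ll using (AllUnrestricted; _≤*_; Split; []; share; first; second)
  open Zoning l using () renaming (Split to Split-l)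
  open Formulas

  -- Translation of formulas and sequents.

  data Side : Set where
    left right : Side

  opposite : Side → Side
  opposite left  = right
  opposite right = left

  mutual
    -- Every `!` gets zone `u`: its right rule then accepts all left formulas but no right formula
    -- in zone `w`. Every `?` gets zone `w`, which lies below both zones, so its left rule is always
    -- applicable.
    positive : Side → FI.Positive intuitionistic → FC.Positive classical
    positive left  (atom p)   = ![ u ] atom (inj₁ p)
    positive right (atom p)   = atom (inj₁ p)
    positive s     (P ⊗ Q)    = positive s P ⊗ positive s Q
    positive s     (P ⊕ Q)    = positive s P ⊕ positive s Q
    positive s     𝟏          = 𝟏
    positive s     𝟎          = 𝟎
    positive s     (![ _ ] N) = ![ u ] ň s N

    negative : Side → FI.Negative intuitionistic → FC.Negative classical
    negative s (atom n)   = atom (inj₁ n)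
    negative s (N & M)    = negative s N & negative s M
    negative s top        = top
    negative s (P ⊸ N)    = positive (opposite s) P ⊸ negative s N
    negative s (?[ _ ] P) = ?[ w ] p̂ s P

    p̂ : Side → FI.P̂ intuitionistic → FC.P̂ classical
    p̂ s     (pos P)  = pos (positive s P)
    p̂ left  (atom n) = pos (![ u ] neg (atom (inj₁ n)))
    p̂ right (atom n) = atom (inj₁ n)

    ň : Side → FI.Ň intuitionistic → FC.Ň classical
    ň s (neg N)  = neg (negative s N)
    ň s (atom p) = atom (inj₁ p)

  onLeft : I.Left → C.Left
  onLeft (_ , N) = u , ň left N

  onRight : I.Right → C.Right
  onRight (_ , Q) = w , p̂ right Q

  -- This computes for a variable context, where the `partitionSums` in `encode` is stuck. All
  -- constructions use this form, and the result is transported to `encode` at the end.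
  neutral : I.Neutral → C.Neutral
  neutral (Γ , R) = map onLeft Γ , [ onRight R ]

  activeRight : I.Goal → List (FC.Ň classical)
  activeRight (I.active N)  = [ ň right N ]
  activeRight (I.passive _) = []

  passiveRight : I.Goal → List C.Right
  passiveRight (I.active _)  = []
  passiveRight (I.passive R) = [ onRight R ]

  unrestricted-l : ∀ {Γ : List I.Left} → Zoning.AllUnrestricted l Γ
  unrestricted-l = All.universal _ _

  unrestricted-ll : ∀ Γ → AllUnrestricted (map onLeft Γ)
  unrestricted-ll []      = []
  unrestricted-ll (_ ∷ Γ) = u ∷ unrestricted-ll Γ

  w-restricted : ¬ Unrestricted w
  w-restricted ()

  -- Translation of derivations.

  Translation : List C.Left → List (FC.P̂ classical) →
                List (FC.Ň classical) → List C.Right → List I.Neutral → Set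
  Translation Γ Ω Ξ Δ Ss = Σ[ c ∈ C.Active Γ Ω Ξ Δ ] C.premisesA c ≡ map neutral Ss

  concat-premises : ∀ {Ts Ts′ Ss Ss′} → Ts ≡ map neutral Ss → Ts′ ≡ map neutral Ss′ →
                    Ts ++ Ts′ ≡ map neutral (Ss ++ Ss′)
  concat-premises {Ss = Ss} p q = trans (cong₂ _++_ p q) (sym (map-++ neutral Ss _))

  -- Mapping commutes with deletion only up to a propositional equality. `Ω₀` holds the subformulas
  -- that the rule has just released.
  translation-─ : ∀ Ω₀ {P Ω Γ Ξ Δ Ss} (i : P ∈ Ω) →
           Translation Γ (Ω₀ ++ map (p̂ left) (Ω ─ i)) Ξ Δ Ss →
           Translation Γ (Ω₀ ++ (map (p̂ left) Ω ─ ∈-map⁺ (p̂ left) i)) Ξ Δ Ss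
  translation-─ Ω₀ i = subst (λ Ω → Translation _ (Ω₀ ++ Ω) _ _ _) (map-─ (p̂ left) i)

  -- The derivation and the equation for its premises are built together, so that each transport
  -- along `map-─` carries both.
  toA : ∀ {Γ Ω G} (d : I.Active Γ Ω G) →
        Translation (map onLeft Γ) (map (p̂ left) Ω) (activeRight G) (passiveRight G)
                    (I.premisesA d)
  toA I.open-leaf    = C.open-leaf , refl
  toA (I.atom⁺R d)   = Product.map (C.atom⁺R (here refl)) id (toA d)
  toA (I.atom⁻R d)   = Product.map (C.atom⁻R (here refl)) id (toA d)
  toA (I.&R d e)     = Product.zip (C.&R (here refl)) concat-premises (toA d) (toA e)
  toA I.topR         = C.topR (here refl) , refl
  toA (I.⊸R d)       = Product.map (C.⊸R (here refl)) id (toA d)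
  toA (I.?R d)       = Product.map (C.?R (here refl)) id (toA d)
  -- On the left an atom has become `![ u ]` of itself, so `!L` is the rule that stores it.
  toA (I.atom⁺L i d) = Product.map (C.!L (∈-map⁺ _ i)) id (translation-─ [] i (toA d))
  toA (I.atom⁻L i d) = Product.map (C.!L (∈-map⁺ _ i)) id (translation-─ [] i (toA d))
  toA (I.⊗L i d)     = Product.map (C.⊗L (∈-map⁺ _ i)) id (translation-─ (_ ∷ _ ∷ []) i (toA d))
  toA (I.𝟏L i d)     = Product.map (C.𝟏L (∈-map⁺ _ i)) id (translation-─ [] i (toA d))
  toA (I.⊕L i d e)   = Product.zip (C.⊕L (∈-map⁺ _ i)) concat-premises
                         (translation-─ [ _ ] i (toA d)) (translation-─ [ _ ] i (toA e))
  toA (I.𝟎L i)       = C.𝟎L (∈-map⁺ _ i) , refl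
  toA (I.!L i d)     = Product.map (C.!L (∈-map⁺ _ i)) id (translation-─ [] i (toA d))

  ≤*-u : ∀ Γ → u ≤* map onLeft Γ
  ≤*-u []      = []
  ≤*-u (_ ∷ Γ) = refl ∷ ≤*-u Γ

  ≤*-w : ∀ Γ → w ≤* map onLeft Γ
  ≤*-w []      = []
  ≤*-w (_ ∷ Γ) = step w↝u ∷ ≤*-w Γ

  ≤*-l : ∀ {Γ : List I.Left} → Zoning._≤*_ l w Γ
  ≤*-l = All.universal (λ { (w , _) → refl }) _

  toR : ∀ {Γ P} → I.RightFocus Γ P → C.RightFocus (map onLeft Γ) (positive right P) []
  toR {Γ} (I.init i _) = C.init (∈-map⁺ onLeft i) (All.─⁺ (∈-map⁺ onLeft i) (unrestricted-ll Γ)) []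
  toR {Γ} (I.⊗R s d e) with shares-all ← sharesAll unrestricted-l s =
    C.⊗R (share-all (unrestricted-ll Γ)) [] (toR d) (toR e)
  toR {Γ} (I.𝟏R _)     = C.𝟏R (unrestricted-ll Γ) []
  toR (I.⊕R₁ d)        = C.⊕R₁ (toR d)
  toR (I.⊕R₂ d)        = C.⊕R₂ (toR d)
  toR {Γ} (I.!R _ d)   = C.!R (≤*-u Γ) [] (proj₁ (toA d))

  toL : ∀ {Γ N R} → I.LeftFocus Γ N R →
        C.LeftFocus (map onLeft Γ) (negative left N) [ onRight R ]
  toL {Γ} (I.init _)   = C.init (here refl) (unrestricted-ll Γ) []
  toL (I.&L₁ d)        = C.&L₁ (toL d)
  toL (I.&L₂ d)        = C.&L₂ (toL d)
  toL {Γ} (I.⊸L s d e) with shares-all ← sharesAll unrestricted-l s =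
    C.⊸L (share-all (unrestricted-ll Γ)) (second w-restricted []) (toR d) (toL e)
  toL {Γ} (I.?L _ _ d) = C.?L (≤*-w Γ) (refl ∷ []) (proj₁ (toA d))

  to : ∀ {S} → I.Synthetic S → C.Synthetic (neutral S)
  -- Zone `w` is restricted, so the decision uses up the right formula, leaving the empty right
  -- context of an intuitionistic right focus.
  to (I.decideR d)      = C.decideʳR (here refl) w-restricted (toR d)
  -- No zone of `l` is restricted.
  to (I.decideʳL _ r _) = ⊥-elim-irr (r _)
  to (I.decideᵘL i _ d) = C.decideᵘL (∈-map⁺ onLeft i) u (toL d)

  -- Preservation of premises.

  premises-toR : ∀ {Γ P} (d : I.RightFocus Γ P) →
                 C.premisesR (toR d) ≡ map neutral (I.premisesR d)
  premises-toR (I.init _ _) = refl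
  premises-toR (I.⊗R s d e) with shares-all ← sharesAll unrestricted-l s =
    concat-premises (premises-toR d) (premises-toR e)
  premises-toR (I.𝟏R _)     = refl
  premises-toR (I.⊕R₁ d)    = premises-toR d
  premises-toR (I.⊕R₂ d)    = premises-toR d
  premises-toR (I.!R _ d)   = proj₂ (toA d)

  premises-toL : ∀ {Γ N R} (d : I.LeftFocus Γ N R) →
                 C.premisesL (toL d) ≡ map neutral (I.premisesL d)
  premises-toL (I.init _)   = refl
  premises-toL (I.&L₁ d)    = premises-toL d
  premises-toL (I.&L₂ d)    = premises-toL d
  premises-toL (I.⊸L s d e) with shares-all ← sharesAll unrestricted-l s =
    concat-premises (premises-toR d) (premises-toL e)
  premises-toL (I.?L _ _ d) = proj₂ (toA d)

  premises-to : ∀ {S} (d : I.Synthetic S) → C.premises (to d) ≡ map neutral (I.premises d)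
  premises-to (I.decideR d)      = premises-toR d
  premises-to (I.decideʳL _ r _) = ⊥-elim-irr (r _)
  premises-to (I.decideᵘL _ _ d) = premises-toL d

  -- Compatibility with the identification of derivations.

  toR-cong : ∀ {Γ P} {d e : I.RightFocus Γ P} → d I.≈R e → toR d C.≈R toR e
  toR-cong I.init             = C.init
  toR-cong (I.⊗R {s = s} p q) with shares-all ← sharesAll unrestricted-l s =
    C.⊗R (toR-cong p) (toR-cong q)
  toR-cong I.𝟏R               = C.𝟏R
  toR-cong (I.⊕R₁ p)          = C.⊕R₁ (toR-cong p)
  toR-cong (I.⊕R₂ p)          = C.⊕R₂ (toR-cong p)
  toR-cong I.!R               = C.!R

  toL-cong : ∀ {Γ N R} {d e : I.LeftFocus Γ N R} → d I.≈L e → toL d C.≈L toL e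
  toL-cong I.init             = C.init
  toL-cong (I.&L₁ p)          = C.&L₁ (toL-cong p)
  toL-cong (I.&L₂ p)          = C.&L₂ (toL-cong p)
  toL-cong (I.⊸L {s = s} p q) with shares-all ← sharesAll unrestricted-l s =
    C.⊸L (toR-cong p) (toL-cong q)
  toL-cong I.?L               = C.?L

  to-cong : ∀ {S} {d e : I.Synthetic S} → d I.≈ e → to d C.≈ to e
  to-cong (I.decideR p)          = C.decideʳR (toR-cong p)
  to-cong (I.decideʳL {a = r} _) = ⊥-elim-irr (r _)
  to-cong (I.decideᵘL p)         = C.decideᵘL (toL-cong p)

  -- Injectivity.

  init-index : ∀ {Γ Δ z z′ p} {i : (z , atom p) ∈ Γ} {j : (z′ , atom p) ∈ Γ}
               .{a b a′ b′} → C.init {Δ = Δ} i a b C.≈R C.init j a′ b′ → index i ≡ index j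
  init-index C.init = refl

  -- As in `init-index`, the occurrences are variables here, so the equivalence can be matched; at
  -- the point of use they are stuck terms `∈-map⁺ onLeft i`.
  decideᵘL-index : ∀ {Γ Δ z z′ N N′} {i : (z , neg N) ∈ Γ} {j : (z′ , neg N′) ∈ Γ}
                   .{a a′} {d : C.LeftFocus Γ N Δ} {e : C.LeftFocus Γ N′ Δ} →
                   C.decideᵘL i a d C.≈ C.decideᵘL j a′ e → index i ≡ index j
  decideᵘL-index (C.decideᵘL _) = refl

  decideᵘL-injective : ∀ {Γ Δ z N} {i : (z , neg N) ∈ Γ} .{a a′} {d e : C.LeftFocus Γ N Δ} →
                       C.decideᵘL i a d C.≈ C.decideᵘL i a′ e → d C.≈L e
  decideᵘL-injective (C.decideᵘL p) = p

  toR-injective : ∀ {Γ P} (d e : I.RightFocus Γ P) → toR d C.≈R toR e → d I.≈R e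
  toR-injective (I.init i _) (I.init j _) p
    with refl ← ∈-map⁺-index-injective onLeft i j (init-index p) = I.init
  toR-injective (I.⊗R s d e) (I.⊗R s′ d′ e′) p
    -- `toR` reduces on each side only once its split is in canonical form; only then can `p` be
    -- matched.
    with shares-all ← sharesAll unrestricted-l s
       | shares-all ← sharesAll unrestricted-l s′
    with C.⊗R q r ← p = I.⊗R (toR-injective d d′ q) (toR-injective e e′ r)
  toR-injective (I.𝟏R _)   (I.𝟏R _)   _         = I.𝟏R
  toR-injective (I.⊕R₁ d)  (I.⊕R₁ e)  (C.⊕R₁ p) = I.⊕R₁ (toR-injective d e p)
  toR-injective (I.⊕R₂ d)  (I.⊕R₂ e)  (C.⊕R₂ p) = I.⊕R₂ (toR-injective d e p)
  toR-injective (I.!R _ _) (I.!R _ _) _         = I.!R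

  toL-injective : ∀ {Γ N R} (d e : I.LeftFocus Γ N R) → toL d C.≈L toL e → d I.≈L e
  toL-injective (I.init _) (I.init _) _         = I.init
  toL-injective (I.&L₁ d)  (I.&L₁ e)  (C.&L₁ p) = I.&L₁ (toL-injective d e p)
  toL-injective (I.&L₂ d)  (I.&L₂ e)  (C.&L₂ p) = I.&L₂ (toL-injective d e p)
  toL-injective (I.⊸L s d e) (I.⊸L s′ d′ e′) p
    with shares-all ← sharesAll unrestricted-l s
       | shares-all ← sharesAll unrestricted-l s′
    with C.⊸L q r ← p = I.⊸L (toR-injective d d′ q) (toL-injective e e′ r)
  toL-injective (I.?L _ _ _) (I.?L _ _ _) _     = I.?L

  to-injective : ∀ {S} (d e : I.Synthetic S) → to d C.≈ to e → d I.≈ e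
  to-injective (I.decideʳL _ r _) _                  _ = ⊥-elim-irr (r _)
  to-injective _                  (I.decideʳL _ r _) _ = ⊥-elim-irr (r _)
  to-injective (I.decideR d)      (I.decideR e)      (C.decideʳR p) =
    I.decideR (toR-injective d e p)
  to-injective (I.decideᵘL i _ d) (I.decideᵘL j _ e) p
    with refl ← ∈-map⁺-index-injective onLeft i j (decideᵘL-index p) =
    I.decideᵘL (toL-injective d e (decideᵘL-injective p))

  -- Surjectivity.

  -- Since _≈R_ and _≈L_ identify all derivations of an active sequent, a preimage of
  -- a focus rule whose premise is active only needs some derivation of that premise.
  decompose : ∀ {Ω G} P → (∀ Γ → I.Active Γ Ω G) → ∀ Γ → I.Active Γ (pos P ∷ Ω) G
  decompose (atom p)   k Γ = I.atom⁺L (here refl) (k _)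
  decompose (P ⊗ Q)    k Γ = I.⊗L (here refl) (decompose P (decompose Q k) Γ)
  decompose (P ⊕ Q)    k Γ = I.⊕L (here refl) (decompose P k Γ) (decompose Q k Γ)
  decompose 𝟏          k Γ = I.𝟏L (here refl) (k Γ)
  decompose 𝟎          k Γ = I.𝟎L (here refl)
  decompose (![ _ ] N) k Γ = I.!L (here refl) (k _)

  decompose-p̂ : ∀ {G} P Γ → (∀ Γ → I.Active Γ [] G) → I.Active Γ [ P ] G
  decompose-p̂ (pos P)  Γ k = decompose P k Γ
  decompose-p̂ (atom n) Γ k = I.atom⁻L (here refl) (k _)

  -- The continuation is general in the right formula, which is known only at the end of the
  -- decomposition, and in `Γ`, which grows as formulas from the left are stored.
  decomposeR : ∀ {Ω} N → (∀ R Γ → I.Active Γ Ω (I.passive R)) →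
               ∀ Γ → I.Active Γ Ω (I.active (neg N))
  decomposeR (atom n)   k Γ = I.atom⁻R (k _ Γ)
  decomposeR (N & M)    k Γ = I.&R (decomposeR N k Γ) (decomposeR M k Γ)
  decomposeR top        k Γ = I.topR
  decomposeR (P ⊸ N)    k Γ = I.⊸R (decomposeR N (λ R → decompose P (k R)) Γ)
  decomposeR (?[ _ ] P) k Γ = I.?R (k _ Γ)

  decompose-ň : ∀ N Γ → I.Active Γ [] (I.active N)
  decompose-ň (neg N)  Γ = decomposeR N (λ _ _ → I.open-leaf) Γ
  decompose-ň (atom p) Γ = I.atom⁺R I.open-leaf

  right-focus-excludes-w : ∀ {Γ Q} P → ¬ C.RightFocus Γ (positive right P) [ (w , Q) ]
  right-focus-excludes-w (atom _)   (C.init _ _ b) = ⊥-elim-irr (w-restricted (All.head b))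
  -- A formula in zone `w` cannot be shared; it goes to exactly one premise, and the induction
  -- follows it there.
  right-focus-excludes-w (P ⊗ Q)    (C.⊗R _ (share x _) _ _)   = ⊥-elim-irr (w-restricted x)
  right-focus-excludes-w (P ⊗ Q)    (C.⊗R _ (first _ []) d _)  = right-focus-excludes-w P d
  right-focus-excludes-w (P ⊗ Q)    (C.⊗R _ (second _ []) _ e) = right-focus-excludes-w Q e
  right-focus-excludes-w 𝟏          (C.𝟏R _ b)     = ⊥-elim-irr (w-restricted (All.head b))
  right-focus-excludes-w (P ⊕ Q)    (C.⊕R₁ d)      = right-focus-excludes-w P d
  right-focus-excludes-w (P ⊕ Q)    (C.⊕R₂ d)      = right-focus-excludes-w Q d
  right-focus-excludes-w (![ _ ] _) (C.!R _ b _)   = ⊥-elim-irr (u≰w (All.head b))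
    where
    u≰w : ¬ Signature._≤_ ll u w
    u≰w (step ())

  -- Even on `share-all`, `toR` is stuck while `Γ` is a variable. With the split generalised to `s`,
  -- matching on its view lets `toR` reduce.
  toR-⊗R : ∀ {Γ P Q} (s : Split-l Γ Γ Γ) {d : I.RightFocus Γ P} {e : I.RightFocus Γ Q} {c c′} →
           toR d C.≈R c → toR e C.≈R c′ →
           toR (I.⊗R s d e) C.≈R C.⊗R (share-all (unrestricted-ll Γ)) [] c c′
  toR-⊗R s p q with shares-all ← sharesAll unrestricted-l s = C.⊗R p q

  toL-⊸L : ∀ {Γ R P M} (s : Split-l Γ Γ Γ) {d : I.RightFocus Γ P} {e : I.LeftFocus Γ M R} {c c′} →
           toR d C.≈R c → toL e C.≈L c′ →
           toL (I.⊸L s d e) C.≈L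
           C.⊸L (share-all (unrestricted-ll Γ)) (second w-restricted []) c c′
  toL-⊸L s p q with shares-all ← sharesAll unrestricted-l s = C.⊸L p q

  toR-surjective : ∀ {Γ} P (c : C.RightFocus (map onLeft Γ) (positive right P) []) →
                   Σ[ d ∈ I.RightFocus Γ P ] toR d C.≈R c
  toR-surjective {Γ} (atom p) (C.init i _ _) with ∈-map⁺-surjective onLeft Γ i
  -- `ň left` preserves the distinction between atoms and negative formulas, so only an atom can be
  -- the preimage.
  ... | (_ , atom _) , j , refl , refl = I.init j unrestricted-l , C.init
  ... | (_ , neg _)  , _ , ()   , _
  toR-surjective {Γ} (P ⊗ Q) (C.⊗R s [] c c′)
    with shares-all ← sharesAll (unrestricted-ll Γ) s
    with d , p ← toR-surjective P c | e , q ← toR-surjective Q c′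
    = I.⊗R (share-all unrestricted-l) d e , toR-⊗R (share-all unrestricted-l) p q
  toR-surjective 𝟏 (C.𝟏R _ _) = I.𝟏R unrestricted-l , C.𝟏R
  toR-surjective (P ⊕ Q) (C.⊕R₁ c) = Product.map I.⊕R₁ C.⊕R₁ (toR-surjective P c)
  toR-surjective (P ⊕ Q) (C.⊕R₂ c) = Product.map I.⊕R₂ C.⊕R₂ (toR-surjective Q c)
  toR-surjective {Γ} (![ w ] N) (C.!R _ _ _) = I.!R ≤*-l (decompose-ň N Γ) , C.!R

  toL-surjective : ∀ {Γ R} N (c : C.LeftFocus (map onLeft Γ) (negative left N) [ onRight R ]) →
                   Σ[ d ∈ I.LeftFocus Γ N R ] toL d C.≈L c
  toL-surjective {R = _ , atom _} (atom n) (C.init (here refl) _ _) = I.init unrestricted-l , C.init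
  toL-surjective {R = _ , pos _}  (atom n) (C.init (here ()) _ _)
  toL-surjective (N & M) (C.&L₁ c) = Product.map I.&L₁ C.&L₁ (toL-surjective N c)
  toL-surjective (N & M) (C.&L₂ c) = Product.map I.&L₂ C.&L₂ (toL-surjective M c)
  toL-surjective (P ⊸ M) (C.⊸L _ (share x _) _ _)  = ⊥-elim-irr (w-restricted x)
  toL-surjective (P ⊸ M) (C.⊸L _ (first _ []) c _) = ⊥-elim (right-focus-excludes-w P c)
  toL-surjective {Γ} {R} (P ⊸ M) (C.⊸L s (second _ []) c c′)
    with shares-all ← sharesAll (unrestricted-ll Γ) s
    with d , p ← toR-surjective P c | e , q ← toL-surjective M c′
    = I.⊸L (share-all unrestricted-l) d e , toL-⊸L (share-all unrestricted-l) p q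
  toL-surjective {Γ} {w , _} (?[ w ] P) (C.?L _ _ _) =
    I.?L ≤*-l refl (decompose-p̂ P Γ (λ _ → I.open-leaf)) , C.?L

  to-surjective : ∀ {S} (c : C.Synthetic (neutral S)) → Σ[ d ∈ I.Synthetic S ] to d C.≈ c
  to-surjective {_ , (_ , pos P)}  (C.decideʳR (here refl) _ c) =
    Product.map I.decideR C.decideʳR (toR-surjective P c)
  to-surjective {_ , (_ , atom _)} (C.decideʳR (here ()) _ _)
  to-surjective {_ , (_ , pos P)}  (C.decideᵘR (here refl) x _) = ⊥-elim-irr (w-restricted x)
  to-surjective {_ , (_ , atom _)} (C.decideᵘR (here ()) _ _)
  to-surjective {Γ , _} (C.decideʳL i x _) with ∈-map⁺-surjective onLeft Γ i
  -- Everything in the image of `onLeft` has the unrestricted zone `u`.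
  ... | (_ , neg _)  , _ , refl , _ = ⊥-elim-irr (x u)
  ... | (_ , atom _) , _ , ()   , _
  to-surjective {Γ , _} (C.decideᵘL i _ c) with ∈-map⁺-surjective onLeft Γ i
  ... | (_ , neg N)  , j , refl , refl =
    Product.map (I.decideᵘL j _) C.decideᵘL (toL-surjective N c)
  ... | (_ , atom _) , _ , ()   , _

  -- The encoding and its focal adequacy.

  encoding : Encoding l A ll (A ⊎ᴬ noAtoms)
  encoding = record
    { extra   = nothing
    ; onLeft  = inj₁ ∘ onLeft
    ; onRight = inj₂ ∘ onRight
    }

  encode≡neutral : ∀ S → Encoding.encode encoding S ≡ neutral S
  encode≡neutral (Γ , R) = cong (Product.map₂ (onRight R ∷_)) (partitionSums-map-inj₁ onLeft Γ)

  encoding-adequate : FocallyAdequate encoding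
  encoding-adequate S = subst
    (λ T → Σ[ f ∈ Inverse (I.syntheticSetoid S) (C.syntheticSetoid T) ]
             (∀ d → Permutation.Permutation C._≋_ (C.premises (Inverse.to f d))
                      (map (Encoding.encode encoding) (I.premises d))))
    (sym (encode≡neutral S))
    ( bijection⇒inverse to to-cong to-injective to-surjective
    -- The premises correspond in the same order, so the reflexive permutation suffices.
    , λ d → Permutation.refl (Pointwise.map (λ { refl → ↭-refl , ↭-refl })
              (Pointwise.≡⇒Pointwise-≡
                (trans (premises-to d) (map-cong (sym ∘ encode≡neutral) (I.premises d))))))

corollary18 : ∀ (A : Atoms) → Σ[ F ∈ Atoms ] Σ[ E ∈ Encoding l A ll (A ⊎ᴬ F) ] FocallyAdequate E
corollary18 A = noAtoms A , encoding A , encoding-adequate A
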